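{- For all graphs $G$ and $H$, $$\operatorname{tw}(G\boxtimes H)\geq (\operatorname{tw}(G)+1)(\operatorname{tw}(H)+1)-1.$$
   Context: All graphs are simple, finite and undirected. A tree-decomposition of a graph $G$ is a pair $(T,\beta)$ consisting of a tree $T$ and a function $\beta:V(T)\to 2^{V(G)}$ such that (i) for every $v\in V(G)$, the set $\{t\in V(T): v\in\beta(t)\}$ is non-empty and induces a connected subgraph of $T$; and (ii) for every edge $uv\in E(G)$ there is $t\in V(T)$ with $\{u,v\}\subseteq\beta(t)$. Its width is $\max_{t\in V(T)}|\beta(t)|-1$. The treewidth $\operatorname{tw}(G)$ is the minimum width of a tree-decomposition of $G$. The strong product $G\boxtimes H$ is the graph with vertex set $V(G)\times V(H)$, where $(g_1,h_1)(g_2,h_2)$ is an edge if and only if $g_1=g_2$ and $h_1h_2\in E(H)$; or $g_1g_2\in E(G)$ and $h_1=h_2$; or $g_1g_2\in E(G)$ and $h_1h_2\in E(H)$. -}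

module Defs where

open import Level using (0ℓ)
open import Data.Empty using (⊥; ⊥-elim)
open import Data.Fin.Base using (Fin; zero; remQuot)
import Data.Fin.Properties as Fin
open import Data.Fin.Subset using (Subset; _∈_; ∣_∣; ⊤)
open import Data.Fin.Subset.Properties using (∈⊤)
open import Data.Integer.Base as ℤ using (ℤ; +_; 1ℤ)
import Data.Integer.Properties as ℤ
open import Data.List.Base using (List; []; _∷_; _∷ʳ_; length; map; allFin)
open import Data.List.Extrema.Nat using (max)
open import Data.List.Relation.Unary.Linked using (Linked; _∷_)
open import Data.List.Relation.Unary.Unique.Propositional using (Unique)
open import Data.Nat.Base using (ℕ; _*_; _≤_; _<_)
open import Data.Nat.Induction using (<-rec)
open import Data.Nat.Properties using (≰⇒>; _≤?_)
open import Data.Product.Base using (∃; ∃-syntax; ∃₂; _×_; _,_; proj₁; proj₂)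
open import Data.Sum.Base using (_⊎_; inj₁; inj₂)
open import Function.Base using (_∘_)
open import Relation.Binary.Construct.Closure.ReflexiveTransitive using (Star; ε)
open import Relation.Binary.Core using (Rel)
open import Relation.Binary.Definitions using (Decidable; Irreflexive; Symmetric)
open import Relation.Binary.PropositionalEquality using (_≡_; refl; sym; subst)
open import Relation.Nullary using (¬_; yes; no; _×-dec_; _⊎-dec_)
open import Relation.Unary using (Pred)

-- Finite simple graphs, up to a labelling of the vertices by Fin order.
-- The null graph (order 0) is allowed.
record Graph : Set₁ where
  field
    order : ℕ

  Vertex : Set
  Vertex = Fin order

  infix 4 _~_ _~?_
  field
    _~_      : Rel Vertex 0ℓ
    _~?_     : Decidable _~_
    ~-sym    : Symmetric _~_
    ~-irrefl : Irreflexive _≡_ _~_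

open Graph using (order; Vertex)

-- Any two vertices of P are joined by a walk that stays inside P.
InducesConnected : (G : Graph) → Pred (Vertex G) 0ℓ → Set
InducesConnected G P =
  ∀ {x y} → P x → P y → Star (λ u v → P u × P v × u ~ v) x y
  where open Graph G using (_~_)

Connected : Graph → Set
Connected G = Vertex G × (∀ x y → Star _~_ x y)
  where open Graph G using (_~_)

-- A cycle v x₁ … xₖ v has k ≥ 2, that is, at least three distinct vertices.
HasCycle : Graph → Set
HasCycle G = ∃₂ λ (v : Vertex G) (xs : List (Vertex G)) →
  2 ≤ length xs × Unique (v ∷ xs) × Linked _~_ (v ∷ xs ∷ʳ v)
  where open Graph G using (_~_)

IsTree : Graph → Set
IsTree G = Connected G × ¬ HasCycle G

record TreeDecomposition (G : Graph) : Set₁ where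
  open Graph G using (_~_)
  field
    tree             : Graph
    isTree           : IsTree tree
    bag              : Vertex tree → Subset (order G)
    vertex-nonempty  : ∀ v → ∃[ t ] v ∈ bag t
    vertex-connected : ∀ v → InducesConnected tree (λ t → v ∈ bag t)
    edge-covered     : ∀ {u v} → u ~ v → ∃[ t ] (u ∈ bag t × v ∈ bag t)

  -- The tree has at least one vertex, so the default value 0 of max does not
  -- affect the result.
  maxBagSize : ℕ
  maxBagSize = max 0 (map (∣_∣ ∘ bag) (allFin (order tree)))

  -- An integer, since the null graph has decompositions of width -1.
  width : ℤ
  width = + maxBagSize ℤ.- 1ℤ

open TreeDecomposition using (width; maxBagSize)

-- k is the minimum width of a tree-decomposition of G.
IsTreewidth : Graph → ℤ → Set₁
IsTreewidth G k =
  (∃[ D ] width {G} D ≡ k) × (∀ (D : TreeDecomposition G) → k ℤ.≤ width D)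

-- The pair (g , h) is the element  combine g h  of Fin (order G * order H);
-- remQuot is the inverse bijection (Data.Fin.Properties.*↔×).
infixr 7 _⊠_
_⊠_ : Graph → Graph → Graph
G ⊠ H = record
  { order    = order G * order H
  ; _~_      = λ x y → Adj (pair x) (pair y)
  ; _~?_     = λ x y → adj? (pair x) (pair y)
  ; ~-sym    = adj-sym
  ; ~-irrefl = λ { refl → adj-irrefl }
  }
  where
  module G = Graph G
  module H = Graph H

  pair : Fin (order G * order H) → Vertex G × Vertex H
  pair = remQuot {order G} (order H)

  Adj : Rel (Vertex G × Vertex H) 0ℓ
  Adj (g₁ , h₁) (g₂ , h₂) =
      (g₁ ≡ g₂     × h₁ H.~ h₂)
    ⊎ (g₁ G.~ g₂ × h₁ ≡ h₂)
    ⊎ (g₁ G.~ g₂ × h₁ H.~ h₂)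

  adj? : Decidable Adj
  adj? (g₁ , h₁) (g₂ , h₂) =
          (g₁ Fin.≟ g₂ ×-dec h₁ H.~? h₂)
    ⊎-dec (g₁ G.~? g₂ ×-dec h₁ Fin.≟ h₂)
    ⊎-dec (g₁ G.~? g₂ ×-dec h₁ H.~? h₂)

  adj-sym : Symmetric Adj
  adj-sym (inj₁ (p , q))        = inj₁ (sym p , H.~-sym q)
  adj-sym (inj₂ (inj₁ (p , q))) = inj₂ (inj₁ (G.~-sym p , sym q))
  adj-sym (inj₂ (inj₂ (p , q))) = inj₂ (inj₂ (G.~-sym p , H.~-sym q))

  adj-irrefl : ∀ {p} → ¬ Adj p p
  adj-irrefl (inj₁ (_ , q))        = H.~-irrefl refl q
  adj-irrefl (inj₂ (inj₁ (p , _))) = G.~-irrefl refl p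
  adj-irrefl (inj₂ (inj₂ (p , _))) = G.~-irrefl refl p

treewidth-unique : ∀ G {j k} → IsTreewidth G j → IsTreewidth G k → j ≡ k
treewidth-unique G ((D , refl) , minD) ((E , refl) , minE) =
  ℤ.≤-antisym (minD E) (minE D)

oneVertex : Graph
oneVertex = record
  { order    = 1
  ; _~_      = λ _ _ → ⊥
  ; _~?_     = λ _ _ → no λ ()
  ; ~-sym    = λ ()
  ; ~-irrefl = λ _ ()
  }

oneBag : ∀ G → TreeDecomposition G
oneBag G = record
  { tree             = oneVertex
  ; isTree           = (zero , λ { zero zero → ε }) , acyclic
  ; bag              = λ _ → ⊤
  ; vertex-nonempty  = λ _ → zero , ∈⊤
  ; vertex-connected = λ { _ {zero} {zero} _ _ → ε }
  ; edge-covered     = λ _ → zero , ∈⊤ , ∈⊤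
  }
  where
  acyclic : ¬ HasCycle oneVertex
  acyclic (_ , []     , ()  , _)
  acyclic (_ , _ ∷ _  , _   , _ , () ∷ _)

-- The minimum exists, in the classical sense.
treewidth-exists : ∀ G → ¬ ¬ (∃[ k ] IsTreewidth G k)
treewidth-exists G none = <-rec (λ m → ∀ D → ¬ (maxBagSize {G} D ≡ m)) step _ (oneBag G) refl
  where
  step : ∀ m → (∀ {l} → l < m → ∀ D → ¬ (maxBagSize {G} D ≡ l)) →
         ∀ D → ¬ (maxBagSize {G} D ≡ m)
  step m rec D refl = none (width D , (D , refl) , minimal)
    where
    minimal : ∀ E → width D ℤ.≤ width E
    minimal E with maxBagSize D ≤? maxBagSize E
    ... | yes p = ℤ.+-monoˡ-≤ (ℤ.- 1ℤ) (ℤ.+≤+ p)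
    ... | no ¬p = ⊥-elim (rec (≰⇒> ¬p) E refl)

{-# OPTIONS --safe #-}

-- Suppose that tw(H) = k, and let 𝓑 be a bramble of H that no set of at most k
-- vertices covers; it exists by treewidth duality.  Given a tree-decomposition
-- (T, β) of G ⊠ H, put g into the new bag at t if the vertices h with
-- (g , h) ∈ β(t) cover 𝓑.  For fixed g the set of such t is an intersection of
-- subtrees of T, one for each B ∈ 𝓑; for equal or adjacent g and g′ all these
-- subtrees meet pairwise, so by the Helly property they have a common node.
-- Hence the new bags form a tree-decomposition of G; some new bag has at least
-- tw(G) + 1 elements, and each of them accounts for at least k + 1 elements of β(t).
--
-- Duality is proved as by Bellenbaum and Diestel: if every bramble has a cover of
-- size at most k, then by induction on the number of sets outside 𝓑 there is a
-- tree-decomposition in which no bag larger than k covers 𝓑.  Take a smallest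
-- cover X of 𝓑 and attach to the bag X one decomposition for each component C of
-- H − X.  If C does not touch some B ∈ 𝓑, the single bag C ∪ N(C) will do;
-- otherwise restrict a decomposition for 𝓑 ∪ {C} to X ∪ C and reroute X to a large
-- bag that covers 𝓑.  Rerouting does not enlarge any bag, because X is smallest;
-- this replaces the usual appeal to Menger's theorem.
module Submission where

open import Defs
open import Data.Integer using (ℤ; 1ℤ; _+_; _-_; _*_; _≥_)

open import Level using (0ℓ)
open import Data.Bool.Base using (true)
open import Data.Empty using (⊥)
open import Data.Fin.Base using (Fin; zero; splitAt; join; combine)
import Data.Fin.Properties as Fin
open import Data.Fin.Subset as Subset
  using (Subset; ∣_∣; _∪_; _∩_; ∁; ⁅_⁆; _⊃_; inside; outside)
  renaming (_∈_ to _∈ₛ_; _∉_ to _∉ₛ_)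
import Data.Fin.Subset.Properties as Subset
open import Data.Fin.Subset.Induction using (⊃-wellFounded; Acc; acc)
import Data.Integer.Base as ℤ
import Data.Integer.Properties as ℤ
open import Data.List.Base using (List; []; _∷_; _∷ʳ_; [_]; _++_; length; map; allFin; cartesianProduct)
open import Data.List.Extrema.Nat using (max≤v⁺; xs≤max)
open import Data.List.Membership.Propositional using (_∈_; _∉_; find)
open import Data.List.Membership.Propositional.Properties
  using (∈-map⁺; ∈-++⁺ˡ; ∈-++⁺ʳ; ∈-++⁻; ∈-∃++; ∈-allFin; ∈-cartesianProduct⁺; ∈-cartesianProduct⁻)
open import Data.List.Properties using (length-++)
open import Data.List.Relation.Unary.All as All using (All; []; _∷_)
import Data.List.Membership.DecPropositional as DecMembership
import Data.List.Relation.Unary.All.Properties as All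
open import Data.List.Relation.Unary.AllPairs using ([]; _∷_)
open import Data.List.Relation.Unary.Any using (here; there)
open import Data.List.Relation.Unary.Linked using (Linked; [-]; _∷_)
open import Data.List.Relation.Unary.Unique.Propositional using (Unique)
open import Data.Nat.Base as ℕ using (ℕ; zero; suc; z≤n; s≤s)
import Data.Nat.Properties as ℕ
open import Data.Nat.DivMod using (m*n/n≡m; m/n*n≤m; /-monoˡ-≤)
open import Data.Nat.Induction using (<-rec)
open import Data.Product.Base using (Σ-syntax; ∃; ∃-syntax; ∃₂; _×_; _,_; proj₁; proj₂)
open import Data.Sum.Base as Sum using (_⊎_; inj₁; inj₂)
open import Data.Unit.Base using (⊤; tt)
open import Data.Vec.Base as Vec using (Vec; []; _∷_)
import Data.Vec.Properties as Vec
open import Function.Base using (_∘_; id; flip)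
open import Relation.Binary.Construct.Closure.ReflexiveTransitive as Star using (Star; ε; _◅_; _◅◅_)
open import Relation.Binary.Core using (Rel)
open import Relation.Binary.Definitions using (Symmetric)
open import Relation.Binary.PropositionalEquality
  using (_≡_; refl; sym; trans; cong; cong₂; subst; subst₂)
open import Relation.Nullary
  using (¬_; Dec; yes; no; does; contradiction; ¬?; _×-dec_; _⊎-dec_)
open import Relation.Nullary.Decidable using (dec-true; map′)
open import Relation.Unary using (Pred; Decidable)

open Graph using (order; Vertex)

private
  variable
    n : ℕ

-- Walks and simple paths

Walk : (G : Graph) → Pred (Vertex G) 0ℓ → Rel (Vertex G) 0ℓ
Walk G P = Star (λ u v → P u × P v × u ~ v)
  where open Graph G using (_~_)

-- The vertex list is an index, so that membership in it is a predicate to which `InducesConnected`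
-- applies.
data Path (R : Rel (Fin n) 0ℓ) : Fin n → Fin n → List (Fin n) → Set where
  nil  : ∀ {x} → Path R x x [ x ]
  cons : ∀ {x y z ys} → R x y → x ∉ ys → Path R y z ys → Path R x z (x ∷ ys)

module _ {R : Rel (Fin n) 0ℓ} where

  open DecMembership (Fin._≟_ {n}) using (_∈?_)

  start∈ : ∀ {x y ys} → Path R x y ys → x ∈ ys
  start∈ nil          = here refl
  start∈ (cons _ _ _) = here refl

  end∈ : ∀ {x y ys} → Path R x y ys → y ∈ ys
  end∈ nil          = here refl
  end∈ (cons _ _ p) = there (end∈ p)

  suffix : ∀ {x y z ys} → Path R y z ys → x ∈ ys → ∃[ xs ] Path R x z xs
  suffix p@nil          (here refl) = _ , p
  suffix p@(cons _ _ _) (here refl) = _ , p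
  suffix (cons _ _ p)   (there x∈)  = suffix p x∈

  loopErase : ∀ {x y} → Star R x y → ∃[ ys ] Path R x y ys
  loopErase ε = _ , nil
  loopErase {x} (r ◅ w) with loopErase w
  ... | ys , p with x ∈? ys
  ...   | yes x∈ = suffix p x∈
  ...   | no  x∉ = _ , cons r x∉ p

  path-unique : ∀ {x y ys} → Path R x y ys → Unique ys
  path-unique nil           = [] ∷ []
  path-unique (cons _ x∉ p) = All.tabulate (λ { y∈ refl → x∉ y∈ }) ∷ path-unique p

  path-linked : ∀ {S : Rel (Fin n) 0ℓ} {x y z ys} → (∀ {u v} → R u v → S u v) →
                Path R x y ys → S y z → Linked S (ys ∷ʳ z)
  path-linked f nil                         s = s ∷ [-]
  path-linked f (cons r _ p@nil)            s = f r ∷ path-linked f p s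
  path-linked f (cons r _ p@(cons _ _ _))   s = f r ∷ path-linked f p s

module _ (G : Graph) where
  open Graph G hiding (order; Vertex)

  within-sym : {P : Pred (Vertex G) 0ℓ} → Symmetric (λ u v → P u × P v × u ~ v)
  within-sym (p , q , e) = q , p , ~-sym e

  walk-mono : {P Q : Pred (Vertex G) 0ℓ} → (∀ {x} → P x → Q x) →
              ∀ {x y} → Walk G P x y → Walk G Q x y
  walk-mono f = Star.map (λ (p , q , e) → f p , f q , e)

  walk-rev : {P : Pred (Vertex G) 0ℓ} → ∀ {x y} → Walk G P x y → Walk G P y x
  walk-rev = Star.reverse within-sym

  connected-via : {P : Pred (Vertex G) 0ℓ} (c : Vertex G) → (∀ {x} → P x → Walk G P x c) →
                  InducesConnected G P
  connected-via c f px py = f px ◅◅ walk-rev (f py)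

  path-connected : ∀ {x y ys} → Path _~_ x y ys → InducesConnected G (_∈ ys)
  path-connected p = connected-via _ (toEnd p)
    where
    toEnd : ∀ {x y ys} → Path _~_ x y ys → ∀ {v} → v ∈ ys → Walk G (_∈ ys) v y
    toEnd nil (here refl) = ε
    toEnd (cons r _ p) (here refl) =
      (here refl , there (start∈ p) , r) ◅ walk-mono there (toEnd p (start∈ p))
    toEnd (cons _ _ p) (there v∈)  = walk-mono there (toEnd p v∈)

-- Acyclic graphs

  -- This is adjacency in G - ab.
  Avoiding : Vertex G → Vertex G → Rel (Vertex G) 0ℓ
  Avoiding a b u v = u ~ v × ¬ (u ≡ a × v ≡ b) × ¬ (u ≡ b × v ≡ a)

  -- Every edge is a bridge.
  Acyclic : Set
  Acyclic = ∀ {a b} → a ~ b → ¬ Star (Avoiding a b) a b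

  -- A simple path from a to b in G - ab closes up to a cycle with the edge ab. It has at least two
  -- edges, because a path of one edge would be ab itself.
  noCycle⇒acyclic : ¬ HasCycle G → Acyclic
  noCycle⇒acyclic nc e w with loopErase w
  ... | _ , nil                               = ~-irrefl refl e
  ... | _ , cons (_ , p , _) _ nil            = p (refl , refl)
  -- The last two clauses share their body; each exposes a third vertex, so that the length bound
  -- can be checked.
  ... | _ , p@(cons _ _ (cons _ _ nil)) = nc (_ , _ , s≤s (s≤s z≤n) , path-unique p , path-linked proj₁ p (~-sym e))
  ... | _ , p@(cons _ _ (cons _ _ (cons _ _ _))) = nc (_ , _ , s≤s (s≤s z≤n) , path-unique p , path-linked proj₁ p (~-sym e))

  acyclic⇒noCycle : Acyclic → ¬ HasCycle G
  acyclic⇒noCycle ac (v , x ∷ [] , s≤s () , _)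
  acyclic⇒noCycle ac (v , x ∷ y ∷ ys , _ , (v≢x ∷ v≢y ∷ v≢ys) ∷ (x≢y ∷ x≢ys) ∷ _ , e ∷ e′ ∷ l) =
    -- The arc from x through y back to v avoids the edge xv: its first step ends at y, which is
    -- neither end of the edge, and every later step starts outside {x, v}.
    ac (~-sym e) (first ◅ rest ys (v≢y ∷ v≢ys) (x≢y ∷ x≢ys) l)
    where
    first : Avoiding x v x y
    first = e′ , (λ { (_ , refl) → v≢y refl }) , (λ { (refl , _) → v≢x refl })
    rest : ∀ zs {z} → All (λ u → ¬ (v ≡ u)) (z ∷ zs) → All (λ u → ¬ (x ≡ u)) (z ∷ zs) →
           Linked _~_ (z ∷ zs ∷ʳ v) → Star (Avoiding x v) z v
    rest [] (v≢z ∷ _) (x≢z ∷ _) (e ∷ [-]) =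
      (e , (λ (p , _) → x≢z (sym p)) , (λ (p , _) → v≢z (sym p))) ◅ ε
    rest (_ ∷ zs) (v≢z ∷ v≢zs) (x≢z ∷ x≢zs) (e ∷ l) =
      (e , (λ (p , _) → x≢z (sym p)) , (λ (p , _) → v≢z (sym p))) ◅ rest zs v≢zs x≢zs l

  module _ (acyclic : Acyclic) where

    -- In G - xp the vertex u is on the side of x and y is not. Along the walk this side can be left
    -- only by the step from x to p; a step from p to x taken on this side would put p there,
    -- against acyclicity.
    crossing : {Q : Pred (Vertex G) 0ℓ} → ∀ {x p u y} → x ~ p →
               Star (Avoiding x p) x u → ¬ Star (Avoiding x p) x y →
               Walk G Q u y → Q x × Q p × Walk G Q p y
    crossing e r ¬r ε = contradiction r ¬r
    crossing {x = x} {p} e r ¬r (_◅_ {u} {v} (qu , qv , s) w)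
      with (u Fin.≟ x) ×-dec (v Fin.≟ p) | (u Fin.≟ p) ×-dec (v Fin.≟ x)
    ... | yes (refl , refl) | _                 = qu , qv , w
    ... | no _              | yes (refl , refl) = contradiction r (acyclic e)
    ... | no a              | no b              =
      crossing e (r ◅◅ ((s , a , b) ◅ ε)) ¬r w

    avoid-vertex : ∀ {P : Pred (Vertex G) 0ℓ} {x p u v} → ¬ P x → Walk G P u v → Star (Avoiding x p) u v
    avoid-vertex ¬px = Star.map λ (pu , pv , e) →
      e , (λ { (refl , _) → ¬px pu }) , (λ { (_ , refl) → ¬px pv })

    -- The path from p to y, read backwards, avoids x. So if x reached y in G - xp, it would also
    -- reach p.
    head-separated : ∀ {x p y ys} → x ~ p → x ∉ ys → Path _~_ p y ys →
                     ¬ Star (Avoiding x p) x y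
    head-separated e x∉ π r = acyclic e
      (r ◅◅ avoid-vertex x∉ (path-connected π (end∈ π) (start∈ π)))

    -- Each edge of a simple path separates its first vertex from y, so a walk in Q must cross it.
    -- Hence the path between two vertices lies in every connected set that contains them.
    path⊆walk : {Q : Pred (Vertex G) 0ℓ} → ∀ {x y ys} → Path _~_ x y ys →
                Q x → Walk G Q x y → All Q ys
    path⊆walk nil qx w = qx ∷ []
    path⊆walk (cons e x∉ π) qx w with crossing e ε (head-separated e x∉ π) w
    ... | _ , qp , w′ = qx ∷ path⊆walk π qp w′

    ∩-connected : {P Q : Pred (Vertex G) 0ℓ} → InducesConnected G P → InducesConnected G Q →
                  InducesConnected G (λ x → P x × Q x)
    ∩-connected cP cQ {x} {y} (px , qx) (py , qy)
      with _ , π ← loopErase (Star.map (proj₂ ∘ proj₂) (cP px py)) =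
      walk-mono (All.lookup (All.zip (path⊆walk π px (cP px py) , path⊆walk π qx (cQ qx qy))))
                (path-connected π (start∈ π) (end∈ π))

    -- Move along the path in B from x to y, staying in A, until C is reached. If the current vertex
    -- is outside C, the next edge separates it from z, since C joins z to the end of the path
    -- without using that vertex. The walk in A towards z therefore crosses this edge, and the next
    -- vertex is in A too.
    helly₃ : {A B C : Pred (Vertex G) 0ℓ} → Decidable C →
             InducesConnected G A → InducesConnected G B → InducesConnected G C →
             (∃[ x ] (A x × B x)) → (∃[ y ] (B y × C y)) → (∃[ z ] (A z × C z)) →
             ∃[ w ] ((A w × B w) × C w)
    helly₃ {A} {B} {C} C? cA cB cC (x , ax , bx) (y , by , cy) (z , az , cz)
      with _ , π ← loopErase (Star.map (proj₂ ∘ proj₂) (cB bx by)) =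
      go π (path⊆walk π bx (cB bx by)) ax cy
      where
      go : ∀ {x y ys} → Path _~_ x y ys → All B ys → A x → C y → ∃[ w ] ((A w × B w) × C w)
      go nil (b ∷ _) a c = _ , (a , b) , c
      go {x} (cons e x∉ π) (b ∷ bs) a c with C? x
      ... | yes c′ = _ , (a , b) , c′
      ... | no ¬c  = go π bs (proj₁ (proj₂ (crossing e ε separated (cA a az)))) c
        where
        separated : ¬ Star (Avoiding x _) x z
        separated r = head-separated e x∉ π (r ◅◅ avoid-vertex ¬c (cC cz c))

    -- Induction on the list: A is replaced by its intersection with the first set, and `helly₃`
    -- shows that the remaining sets still meet this intersection.
    helly : {I : Set} (F : I → Pred (Vertex G) 0ℓ) → (∀ i → Decidable (F i)) →
            (A : Pred (Vertex G) 0ℓ) → InducesConnected G A → ∃ A →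
            (is : List I) → (∀ {i} → i ∈ is → InducesConnected G (F i)) →
            (∀ {i} → i ∈ is → ∃[ x ] (A x × F i x)) →
            (∀ {i j} → i ∈ is → j ∈ is → ∃[ x ] (F i x × F j x)) →
            ∃[ x ] (A x × (∀ {i} → i ∈ is → F i x))
    helly F F? A cA (a , pa) [] cF AF FF = a , pa , λ ()
    helly F F? A cA _ (i ∷ is) cF AF FF
      with helly F F? (λ x → A x × F i x) (∩-connected cA (cF (here refl))) (AF (here refl)) is
             (cF ∘ there)
             (λ {j} j∈ → helly₃ (F? j) cA (cF (here refl)) (cF (there j∈))
                (AF (here refl)) (FF (here refl) (there j∈)) (AF (there j∈)))
             (λ i∈ j∈ → FF (there i∈) (there j∈))
    ... | x , (ax , fx) , rest = x , ax , λ { (here refl) → fx ; (there j∈) → rest j∈ }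

-- Subsets

module _ {P : Pred (Fin n) 0ℓ} (P? : Decidable P) where

  select : Subset n
  select = Vec.tabulate (does ∘ P?)

  ∈-select⁺ : ∀ {x} → P x → x ∈ₛ select
  ∈-select⁺ {x} px = Vec.lookup⇒[]= x _ (trans (Vec.lookup∘tabulate _ x) (dec-true (P? x) px))

  ∈-select⁻ : ∀ {x} → x ∈ₛ select → P x
  ∈-select⁻ {x} x∈ = does-true (P? x) (trans (sym (Vec.lookup∘tabulate _ x)) (Vec.[]=⇒lookup x∈))
    where
    does-true : ∀ {A : Set} (A? : Dec A) → does A? ≡ true → A
    does-true (yes a) _ = a

∣∩∣+∣∩∁∣ : (p q : Subset n) → ∣ p ∣ ≡ ∣ p ∩ q ∣ ℕ.+ ∣ p ∩ ∁ q ∣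
∣∩∣+∣∩∁∣ [] [] = refl
∣∩∣+∣∩∁∣ (inside ∷ p) (inside ∷ q)   = cong suc (∣∩∣+∣∩∁∣ p q)
∣∩∣+∣∩∁∣ (inside ∷ p) (outside ∷ q)  = trans (cong suc (∣∩∣+∣∩∁∣ p q)) (sym (ℕ.+-suc _ _))
∣∩∣+∣∩∁∣ (outside ∷ p) (inside ∷ q)  = ∣∩∣+∣∩∁∣ p q
∣∩∣+∣∩∁∣ (outside ∷ p) (outside ∷ q) = ∣∩∣+∣∩∁∣ p q

∣∪∣≤∣∣+∣∣ : (p q : Subset n) → ∣ p ∪ q ∣ ℕ.≤ ∣ p ∣ ℕ.+ ∣ q ∣
∣∪∣≤∣∣+∣∣ [] [] = z≤n
∣∪∣≤∣∣+∣∣ (inside ∷ p) (inside ∷ q)   = s≤s (ℕ.≤-trans (∣∪∣≤∣∣+∣∣ p q) (ℕ.+-monoʳ-≤ ∣ p ∣ (ℕ.n≤1+n _)))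
∣∪∣≤∣∣+∣∣ (inside ∷ p) (outside ∷ q)  = s≤s (∣∪∣≤∣∣+∣∣ p q)
∣∪∣≤∣∣+∣∣ (outside ∷ p) (inside ∷ q)  =
  subst (suc ∣ p ∪ q ∣ ℕ.≤_) (sym (ℕ.+-suc _ _)) (s≤s (∣∪∣≤∣∣+∣∣ p q))
∣∪∣≤∣∣+∣∣ (outside ∷ p) (outside ∷ q) = ∣∪∣≤∣∣+∣∣ p q

-- The bound |W| ≤ |V| for rerouted bags: if it fails, trading X ∩ W for V ∖ C
-- makes X smaller.
exchange-< : (X W V C : Subset n) →
             (∀ {x} → x ∈ₛ W → x ∉ₛ C → x ∈ₛ X) → (∀ {x} → x ∈ₛ W → x ∈ₛ C → x ∈ₛ V) →
             ∣ V ∣ ℕ.< ∣ W ∣ → ∣ (X ∩ ∁ W) ∪ (V ∩ ∁ C) ∣ ℕ.< ∣ X ∣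
exchange-< X W V C W∖C⊆X W∩C⊆V V<W = begin-strict
  ∣ (X ∩ ∁ W) ∪ (V ∩ ∁ C) ∣        ≤⟨ ∣∪∣≤∣∣+∣∣ (X ∩ ∁ W) (V ∩ ∁ C) ⟩
  ∣ X ∩ ∁ W ∣ ℕ.+ ∣ V ∩ ∁ C ∣      <⟨ ℕ.+-monoʳ-< ∣ X ∩ ∁ W ∣ V∖C<X∩W ⟩
  ∣ X ∩ ∁ W ∣ ℕ.+ ∣ X ∩ W ∣        ≡⟨ ℕ.+-comm ∣ X ∩ ∁ W ∣ _ ⟩
  ∣ X ∩ W ∣ ℕ.+ ∣ X ∩ ∁ W ∣        ≡⟨ ∣∩∣+∣∩∁∣ X W ⟨
  ∣ X ∣                            ∎
  where
  open ℕ.≤-Reasoning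
  W∩C≤ : ∣ W ∩ C ∣ ℕ.≤ ∣ V ∩ C ∣
  W∩C≤ = Subset.p⊆q⇒∣p∣≤∣q∣ λ x∈ → let (w , c) = Subset.x∈p∩q⁻ W C x∈ in
    Subset.x∈p∩q⁺ (W∩C⊆V w c , c)
  W∖C≤ : ∣ W ∩ ∁ C ∣ ℕ.≤ ∣ X ∩ W ∣
  W∖C≤ = Subset.p⊆q⇒∣p∣≤∣q∣ λ x∈ → let (w , c) = Subset.x∈p∩q⁻ W (∁ C) x∈ in
    Subset.x∈p∩q⁺ (W∖C⊆X w (Subset.x∈∁p⇒x∉p c) , w)
  V∖C<X∩W : ∣ V ∩ ∁ C ∣ ℕ.< ∣ X ∩ W ∣
  V∖C<X∩W = ℕ.+-cancelˡ-< ∣ V ∩ C ∣ _ _ (begin-strict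
    ∣ V ∩ C ∣ ℕ.+ ∣ V ∩ ∁ C ∣ ≡⟨ ∣∩∣+∣∩∁∣ V C ⟨
    ∣ V ∣                     <⟨ V<W ⟩
    ∣ W ∣                     ≡⟨ ∣∩∣+∣∩∁∣ W C ⟩
    ∣ W ∩ C ∣ ℕ.+ ∣ W ∩ ∁ C ∣ ≤⟨ ℕ.+-mono-≤ W∩C≤ W∖C≤ ⟩
    ∣ V ∩ C ∣ ℕ.+ ∣ X ∩ W ∣   ∎)

smallest : {P : Pred (Subset n) 0ℓ} → Decidable P → ∀ X → P X →
           ∃[ Y ] (P Y × (∀ {Z} → P Z → ∣ Y ∣ ℕ.≤ ∣ Z ∣))
smallest {n} {P} P? X pX = <-rec Q step _ X refl pX
  where
  Q : ℕ → Set
  Q m = ∀ X → ∣ X ∣ ≡ m → P X → ∃[ Y ] (P Y × (∀ {Z} → P Z → ∣ Y ∣ ℕ.≤ ∣ Z ∣))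
  step : ∀ m → (∀ {l} → l ℕ.< m → Q l) → Q m
  step m rec X refl pX with Subset.anySubset? (λ Y → P? Y ×-dec (∣ Y ∣ ℕ.<? ∣ X ∣))
  ... | yes (Y , pY , Y<X) = rec Y<X Y refl pY
  ... | no none = X , pX , λ {Z} pZ → ℕ.≮⇒≥ λ Z<X → none (Z , pZ , Z<X)

allSubsets : ∀ n → List (Subset n)
allSubsets zero    = [ [] ]
allSubsets (suc n) = map (inside ∷_) (allSubsets n) ++ map (outside ∷_) (allSubsets n)

∈-allSubsets : (X : Subset n) → X ∈ allSubsets n
∈-allSubsets []            = here refl
∈-allSubsets (inside ∷ X)  = ∈-++⁺ˡ (∈-map⁺ (inside ∷_) (∈-allSubsets X))
∈-allSubsets (outside ∷ X) = ∈-++⁺ʳ (map (inside ∷_) (allSubsets _)) (∈-map⁺ (outside ∷_) (∈-allSubsets X))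

-- Traces and bag sizes in tree-decompositions

module _ {G : Graph} (D : TreeDecomposition G) where
  open Graph G hiding (order; Vertex)
  open TreeDecomposition D

  Hits : Pred (Vertex G) 0ℓ → Pred (Vertex tree) 0ℓ
  Hits P t = ∃[ v ] (P v × v ∈ₛ bag t)

  -- Consecutive vertices of the walk share a bag, so their subtrees overlap and can be traversed
  -- one after another.
  trace-walk : {P : Pred (Vertex G) 0ℓ} → ∀ {x y s t} → P x → x ∈ₛ bag s → y ∈ₛ bag t →
               Walk G P x y → Walk tree (Hits P) s t
  trace-walk px x∈ y∈ ε = walk-mono tree (λ v∈ → _ , px , v∈) (vertex-connected _ x∈ y∈)
  trace-walk px x∈ y∈ ((_ , pz , e) ◅ w) with edge-covered e
  ... | _ , x∈′ , z∈ =
    walk-mono tree (λ v∈ → _ , px , v∈) (vertex-connected _ x∈ x∈′) ◅◅ trace-walk pz z∈ y∈ w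

  trace-connected : {P : Pred (Vertex G) 0ℓ} → InducesConnected G P → InducesConnected tree (Hits P)
  trace-connected c (_ , px , x∈) (_ , py , y∈) = trace-walk px x∈ y∈ (c px py)

  bag≤maxBagSize : ∀ t → ∣ bag t ∣ ℕ.≤ maxBagSize
  bag≤maxBagSize t = All.lookup (xs≤max 0 (map (∣_∣ ∘ bag) (allFin _))) (∈-map⁺ (∣_∣ ∘ bag) (∈-allFin t))

  maxBagSize≤ : ∀ {k} → (∀ t → ∣ bag t ∣ ℕ.≤ k) → maxBagSize ℕ.≤ k
  -- `z≤n` handles the default value 0 of `max`.
  maxBagSize≤ h = max≤v⁺ z≤n (All.map⁺ {xs = allFin (order tree)} (All.tabulate (λ {t} _ → h t)))

-- Brambles

module _ (H : Graph) where
  open Graph H hiding (order; Vertex)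

  Touch : Rel (Subset (order H)) 0ℓ
  Touch A B = ∃₂ λ a b → (a ∈ₛ A × b ∈ₛ B) × (a ≡ b ⊎ a ~ b)

  touch? : ∀ A B → Dec (Touch A B)
  touch? A B = Fin.any? λ a → Fin.any? λ b →
    ((a Subset.∈? A) ×-dec (b Subset.∈? B)) ×-dec ((a Fin.≟ b) ⊎-dec (a ~? b))

  touch-sym : Symmetric Touch
  touch-sym (a , b , (a∈ , b∈) , inj₁ p) = b , a , (b∈ , a∈) , inj₁ (sym p)
  touch-sym (a , b , (a∈ , b∈) , inj₂ e) = b , a , (b∈ , a∈) , inj₂ (~-sym e)

  -- The case A = B of `touching` forces every member to be non-empty.
  record Bramble (𝓑 : List (Subset (order H))) : Set where
    field
      connected : ∀ {B} → B ∈ 𝓑 → InducesConnected H (_∈ₛ B)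
      touching  : ∀ {A B} → A ∈ 𝓑 → B ∈ 𝓑 → Touch A B

Covers : Subset n → List (Subset n) → Set
Covers X = All (λ B → ∃[ x ] (x ∈ₛ B × x ∈ₛ X))

covers? : (𝓑 : List (Subset n)) → Decidable (λ X → Covers X 𝓑)
covers? 𝓑 X = All.all? (λ B → Fin.any? λ x → (x Subset.∈? B) ×-dec (x Subset.∈? X)) 𝓑

-- Starting with v alone, a neighbour outside both C and X is added as long as there is one. C grows
-- strictly, so this stops, and then every neighbour of C lies in C or X.
component : (G : Graph) (X : Subset (order G)) (v : Vertex G) → v ∉ₛ X → let open Graph G using (_~_) in
  ∃[ C ] (v ∈ₛ C × InducesConnected G (_∈ₛ C) × (∀ {u} → u ∈ₛ C → u ∉ₛ X) ×
          (∀ {u w} → u ∈ₛ C → u ~ w → w ∈ₛ C ⊎ w ∈ₛ X))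
component G X v v∉X = grow ⁅ v ⁆ (⊃-wellFounded _) (Subset.x∈⁅x⁆ v)
  (λ u∈ → subst (Walk G _ _) (Subset.x∈⁅y⁆⇒x≡y v u∈) ε)
  (λ u∈ → subst (_∉ₛ X) (sym (Subset.x∈⁅y⁆⇒x≡y v u∈)) v∉X)
  where
  open Graph G hiding (order; Vertex)
  grow : ∀ C → Acc _⊃_ C → v ∈ₛ C → (∀ {u} → u ∈ₛ C → Walk G (_∈ₛ C) u v) →
         (∀ {u} → u ∈ₛ C → u ∉ₛ X) →
         ∃[ C ] (v ∈ₛ C × InducesConnected G (_∈ₛ C) × (∀ {u} → u ∈ₛ C → u ∉ₛ X) ×
                 (∀ {u w} → u ∈ₛ C → u ~ w → w ∈ₛ C ⊎ w ∈ₛ X))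
  grow C (acc rs) v∈ walks C∩X=∅
    with Fin.any? (λ u → Fin.any? (λ w →
      (u Subset.∈? C) ×-dec ¬? (w Subset.∈? C) ×-dec ¬? (w Subset.∈? X) ×-dec (u ~? w)))
  ... | no none = C , v∈ , connected-via G v walks , C∩X=∅ , closed
    where
    closed : ∀ {u w} → u ∈ₛ C → u ~ w → w ∈ₛ C ⊎ w ∈ₛ X
    closed {u} {w} u∈ e with w Subset.∈? C | w Subset.∈? X
    ... | yes p | _     = inj₁ p
    ... | no _  | yes q = inj₂ q
    ... | no p  | no q  = contradiction (u , w , u∈ , p , q , e) none
  ... | yes (u , w , u∈ , w∉C , w∉X , e) =
    grow (C ∪ ⁅ w ⁆) (rs (old , w , new , w∉C)) (old v∈) walks′ disjoint′
    where
    old : ∀ {x} → x ∈ₛ C → x ∈ₛ C ∪ ⁅ w ⁆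
    old = Subset.p⊆p∪q ⁅ w ⁆
    new : w ∈ₛ C ∪ ⁅ w ⁆
    new = Subset.q⊆p∪q C ⁅ w ⁆ (Subset.x∈⁅x⁆ w)
    walks′ : ∀ {x} → x ∈ₛ C ∪ ⁅ w ⁆ → Walk G (_∈ₛ C ∪ ⁅ w ⁆) x v
    walks′ x∈ with Subset.x∈p∪q⁻ C ⁅ w ⁆ x∈
    ... | inj₁ p = walk-mono G old (walks p)
    ... | inj₂ q with refl ← Subset.x∈⁅y⁆⇒x≡y w q =
      (new , old u∈ , ~-sym e) ◅ walk-mono G old (walks u∈)
    disjoint′ : ∀ {x} → x ∈ₛ C ∪ ⁅ w ⁆ → x ∉ₛ X
    disjoint′ x∈ with Subset.x∈p∪q⁻ C ⁅ w ⁆ x∈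
    ... | inj₁ p = C∩X=∅ p
    ... | inj₂ q = subst (_∉ₛ X) (sym (Subset.x∈⁅y⁆⇒x≡y w q)) w∉X

-- Joining two trees by a bridge

module _ (S T : Graph) (s : Vertex S) (t : Vertex T) where
  private
    module S = Graph S
    module T = Graph T
    V = Vertex S ⊎ Vertex T

    split : Fin (order S ℕ.+ order T) → V
    split = splitAt (order S)

  data Bridged : Rel V 0ℓ where
    left    : ∀ {a b} → a S.~ b → Bridged (inj₁ a) (inj₁ b)
    right   : ∀ {a b} → a T.~ b → Bridged (inj₂ a) (inj₂ b)
    bridge  : Bridged (inj₁ s) (inj₂ t)
    bridge⁻ : Bridged (inj₂ t) (inj₁ s)

  private
    bridged? : ∀ x y → Dec (Bridged x y)
    bridged? (inj₁ a) (inj₁ b) = map′ left (λ { (left e) → e }) (a S.~? b)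
    bridged? (inj₂ a) (inj₂ b) = map′ right (λ { (right e) → e }) (a T.~? b)
    bridged? (inj₁ a) (inj₂ b) =
      map′ (λ { (refl , refl) → bridge }) (λ { bridge → refl , refl }) ((a Fin.≟ s) ×-dec (b Fin.≟ t))
    bridged? (inj₂ a) (inj₁ b) =
      map′ (λ { (refl , refl) → bridge⁻ }) (λ { bridge⁻ → refl , refl }) ((a Fin.≟ t) ×-dec (b Fin.≟ s))

    bridged-sym : Symmetric Bridged
    bridged-sym (left e)  = left (S.~-sym e)
    bridged-sym (right e) = right (T.~-sym e)
    bridged-sym bridge    = bridge⁻
    bridged-sym bridge⁻   = bridge

    bridged-irrefl : ∀ {x} → ¬ Bridged x x
    bridged-irrefl (left e)  = S.~-irrefl refl e
    bridged-irrefl (right e) = T.~-irrefl refl e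

  bridgeJoin : Graph
  bridgeJoin = record
    { order    = order S ℕ.+ order T
    ; _~_      = λ x y → Bridged (split x) (split y)
    ; _~?_     = λ x y → bridged? (split x) (split y)
    ; ~-sym    = bridged-sym
    ; ~-irrefl = λ { refl → bridged-irrefl }
    }

  private
    fromSplit : ∀ i → join (order S) (order T) (split i) ≡ i
    fromSplit = Fin.join-splitAt (order S) (order T)

    toSplit : ∀ x → split (join (order S) (order T) x) ≡ x
    toSplit = Fin.splitAt-join (order S) (order T)

  -- A set that meets both trees is required to contain both ends of the bridge, so a walk inside it
  -- can change sides there.
  bridgeJoin-induces : {P : Pred V 0ℓ} → InducesConnected S (P ∘ inj₁) → InducesConnected T (P ∘ inj₂) →
                       (∀ {a b} → P (inj₁ a) → P (inj₂ b) → P (inj₁ s) × P (inj₂ t)) →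
                       InducesConnected bridgeJoin (P ∘ split)
  bridgeJoin-induces {P} cS cT cross {x} {y} px py =
    subst₂ (Walk bridgeJoin (P ∘ split)) (fromSplit x) (fromSplit y)
      (Star.gmap (join _ _) (λ {u} {v} (pu , pv , e) →
          subst P (sym (toSplit u)) pu , subst P (sym (toSplit v)) pv ,
          subst₂ Bridged (sym (toSplit u)) (sym (toSplit v)) e)
        (walk (split x) (split y) px py))
    where
    Step : Rel V 0ℓ
    Step u v = P u × P v × Bridged u v
    walkS : ∀ {a b} → P (inj₁ a) → P (inj₁ b) → Star Step (inj₁ a) (inj₁ b)
    walkS p q = Star.gmap inj₁ (λ (p , q , e) → p , q , left e) (cS p q)
    walkT : ∀ {a b} → P (inj₂ a) → P (inj₂ b) → Star Step (inj₂ a) (inj₂ b)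
    walkT p q = Star.gmap inj₂ (λ (p , q , e) → p , q , right e) (cT p q)
    walk : ∀ x y → P x → P y → Star Step x y
    walk (inj₁ a) (inj₁ b) p q = walkS p q
    walk (inj₂ a) (inj₂ b) p q = walkT p q
    walk (inj₁ a) (inj₂ b) p q with cross p q
    ... | ps , pt = walkS p ps ◅◅ ((ps , pt , bridge) ◅ walkT pt q)
    walk (inj₂ a) (inj₁ b) p q with cross q p
    ... | ps , pt = walkT p pt ◅◅ ((pt , ps , bridge⁻) ◅ walkS ps q)

  private
    AvoidingV : V → V → Rel V 0ℓ
    AvoidingV a b u v = Bridged u v × ¬ (u ≡ a × v ≡ b) × ¬ (u ≡ b × v ≡ a)

    invariant : ∀ {R : Rel V 0ℓ} (I : Pred V 0ℓ) → (∀ {u v} → R u v → I u → I v) →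
                ∀ {x y} → Star R x y → I x → I y
    invariant I f ε       i = i
    invariant I f (r ◅ w) i = invariant I f w (f r i)

    bridged-acyclic : Acyclic S → Acyclic T → ∀ {a b} → Bridged a b → ¬ Star (AvoidingV a b) a b
    bridged-acyclic acS _ (left {a} {b} e) w = acS e (invariant I step w ε)
      where
      -- Contracting T to s projects the walk to S, where it still avoids ab; steps in T and across
      -- the bridge leave the projection fixed.
      I : Pred V 0ℓ
      I (inj₁ x) = Star (Avoiding S a b) a x
      I (inj₂ _) = Star (Avoiding S a b) a s
      step : ∀ {u v} → AvoidingV (inj₁ a) (inj₁ b) u v → I u → I v
      step (left f , p , q) i =
        i ◅◅ ((f , (λ { (refl , refl) → p (refl , refl) }) , (λ { (refl , refl) → q (refl , refl) })) ◅ ε)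
      step (right _ , _) i = i
      step (bridge , _)  i = i
      step (bridge⁻ , _) i = i
    bridged-acyclic _ acT (right {a} {b} e) w = acT e (invariant I step w ε)
      where
      I : Pred V 0ℓ
      I (inj₁ _) = Star (Avoiding T a b) a t
      I (inj₂ x) = Star (Avoiding T a b) a x
      step : ∀ {u v} → AvoidingV (inj₂ a) (inj₂ b) u v → I u → I v
      step (right f , p , q) i =
        i ◅◅ ((f , (λ { (refl , refl) → p (refl , refl) }) , (λ { (refl , refl) → q (refl , refl) })) ◅ ε)
      step (left _ , _) i = i
      step (bridge , _)  i = i
      step (bridge⁻ , _) i = i
    bridged-acyclic _ _ bridge w = invariant I step w tt
      where
      -- Without the bridge, a walk from s never leaves S.
      I : Pred V 0ℓ
      I (inj₁ _) = ⊤
      I (inj₂ _) = ⊥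
      step : ∀ {u v} → AvoidingV (inj₁ s) (inj₂ t) u v → I u → I v
      step (left _ , _)     _ = tt
      step (bridge , p , _) _ = p (refl , refl)
    bridged-acyclic _ _ bridge⁻ w = invariant I step w tt
      where
      I : Pred V 0ℓ
      I (inj₁ _) = ⊥
      I (inj₂ _) = ⊤
      step : ∀ {u v} → AvoidingV (inj₂ t) (inj₁ s) u v → I u → I v
      step (right _ , _)     _ = tt
      step (bridge⁻ , p , _) _ = p (refl , refl)

  bridgeJoin-acyclic : Acyclic S → Acyclic T → Acyclic bridgeJoin
  bridgeJoin-acyclic acS acT e w = bridged-acyclic acS acT e
    (Star.gmap split (λ (f , p , q) → f , (λ (a , b) → p (inj a , inj b)) , (λ (a , b) → q (inj a , inj b))) w)
    where
    inj : ∀ {i j} → split i ≡ split j → i ≡ j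
    inj {i} {j} eq = trans (sym (fromSplit i)) (trans (cong (join _ _) eq) (fromSplit j))

  bridgeJoin-isTree : IsTree S → IsTree T → IsTree bridgeJoin
  bridgeJoin-isTree ((_ , cS) , ncS) ((_ , cT) , ncT) =
    (join _ _ (inj₁ s) , λ x y → Star.map (proj₂ ∘ proj₂)
      (bridgeJoin-induces {λ _ → ⊤} (λ _ _ → Star.map (λ e → tt , tt , e) (cS _ _))
        (λ _ _ → Star.map (λ e → tt , tt , e) (cT _ _)) (λ _ _ → tt , tt) tt tt)) ,
    acyclic⇒noCycle bridgeJoin
      (bridgeJoin-acyclic (noCycle⇒acyclic S ncS) (noCycle⇒acyclic T ncT))

-- Tree-decompositions of the subgraph induced by U.
record PartialDecomposition (G : Graph) (Adm : Pred (Subset (order G)) 0ℓ) (U : Subset (order G)) : Set₁ where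
  open Graph G using (_~_)
  field
    tree             : Graph
    isTree           : IsTree tree
    bag              : Vertex tree → Subset (order G)
    bag⊆             : ∀ {v t} → v ∈ₛ bag t → v ∈ₛ U
    vertex-nonempty  : ∀ {v} → v ∈ₛ U → ∃[ t ] v ∈ₛ bag t
    vertex-connected : ∀ v → InducesConnected tree (λ t → v ∈ₛ bag t)
    edge-covered     : ∀ {u v} → u ∈ₛ U → v ∈ₛ U → u ~ v → ∃[ t ] (u ∈ₛ bag t × v ∈ₛ bag t)
    admissible       : ∀ t → Adm (bag t)

module _ {G : Graph} {Adm : Pred (Subset (order G)) 0ℓ} where
  open Graph G using (_~_)
  open PartialDecomposition

  singleBag : ∀ U → Adm U → PartialDecomposition G Adm U
  singleBag U adm = record
    { tree             = oneVertex
    ; isTree           = TreeDecomposition.isTree (oneBag G)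
    ; bag              = λ _ → U
    ; bag⊆             = id
    ; vertex-nonempty  = λ u → zero , u
    ; vertex-connected = λ { _ {zero} {zero} _ _ → ε }
    ; edge-covered     = λ u v _ → zero , u , v
    ; admissible       = λ _ → adm
    }

  whole : ∀ {U} → PartialDecomposition G Adm U → (∀ v → v ∈ₛ U) →
          ∃[ D ] (∀ t → Adm (TreeDecomposition.bag {G} D t))
  whole D all = record
    { tree             = tree D
    ; isTree           = isTree D
    ; bag              = bag D
    ; vertex-nonempty  = λ v → vertex-nonempty D (all v)
    ; vertex-connected = vertex-connected D
    ; edge-covered     = edge-covered D (all _) (all _)
    } , admissible D

  -- A vertex in both supports lies in both bags at the ends of the bridge, which keeps its set of
  -- nodes connected. The returned node has the bag of s, so further pieces can be glued on there.
  glue : ∀ {U U′} (D : PartialDecomposition G Adm U) (E : PartialDecomposition G Adm U′)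
         (s : Vertex (tree D)) (t : Vertex (tree E)) →
         (∀ {v} → v ∈ₛ U → v ∈ₛ U′ → v ∈ₛ bag D s × v ∈ₛ bag E t) →
         (∀ {u v} → u ∈ₛ U ∪ U′ → v ∈ₛ U ∪ U′ → u ~ v → (u ∈ₛ U × v ∈ₛ U) ⊎ (u ∈ₛ U′ × v ∈ₛ U′)) →
         Σ[ J ∈ PartialDecomposition G Adm (U ∪ U′) ] ∃[ r ] bag J r ≡ bag D s
  glue {U} {U′} D E s t common edges = record
    { tree             = bridgeJoin (tree D) (tree E) s t
    ; isTree           = bridgeJoin-isTree (tree D) (tree E) s t (isTree D) (isTree E)
    ; bag              = bags ∘ splitAt (order (tree D))
    ; bag⊆             = λ {v} {r} → bags⊆ (splitAt (order (tree D)) r)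
    ; vertex-nonempty  = λ v∈ → Sum.[ inD (_ ∈ₛ_) ∘ vertex-nonempty D , inE (_ ∈ₛ_) ∘ vertex-nonempty E ]′
                                  (Subset.x∈p∪q⁻ U U′ v∈)
    ; vertex-connected = λ v → bridgeJoin-induces (tree D) (tree E) s t {λ x → v ∈ₛ bags x}
                                 (vertex-connected D v) (vertex-connected E v)
                                 (λ p q → common (bag⊆ D p) (bag⊆ E q))
    ; edge-covered     = λ u∈ v∈ e → Sum.[ (λ (p , q) → inD (λ B → _ ∈ₛ B × _ ∈ₛ B) (edge-covered D p q e))
                                         , (λ (p , q) → inE (λ B → _ ∈ₛ B × _ ∈ₛ B) (edge-covered E p q e))
                                         ]′ (edges u∈ v∈ e)
    ; admissible       = λ r → bags-admissible (splitAt (order (tree D)) r)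
    } , join _ _ (inj₁ s) , cong bags (Fin.splitAt-join (order (tree D)) (order (tree E)) (inj₁ s))
    where
    bags : Vertex (tree D) ⊎ Vertex (tree E) → Subset (order G)
    bags = Sum.[ bag D , bag E ]
    bags⊆ : ∀ {v} x → v ∈ₛ bags x → v ∈ₛ U ∪ U′
    bags⊆ (inj₁ _) = Subset.p⊆p∪q U′ ∘ bag⊆ D
    bags⊆ (inj₂ _) = Subset.q⊆p∪q U U′ ∘ bag⊆ E
    bags-admissible : ∀ x → Adm (bags x)
    bags-admissible (inj₁ r) = admissible D r
    bags-admissible (inj₂ r) = admissible E r
    inD : (P : Pred (Subset (order G)) 0ℓ) → ∃[ r ] P (bag D r) →
          ∃[ r ] P (bags (splitAt (order (tree D)) r))
    inD P (r , p) = join _ _ (inj₁ r) ,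
      subst (P ∘ bags) (sym (Fin.splitAt-join (order (tree D)) (order (tree E)) (inj₁ r))) p
    inE : (P : Pred (Subset (order G)) 0ℓ) → ∃[ r ] P (bag E r) →
          ∃[ r ] P (bags (splitAt (order (tree D)) r))
    inE P (r , p) = join _ _ (inj₂ r) ,
      subst (P ∘ bags) (sym (Fin.splitAt-join (order (tree D)) (order (tree E)) (inj₂ r))) p

-- Treewidth duality

Admissible : ℕ → List (Subset n) → Pred (Subset n) 0ℓ
Admissible k 𝓑 Z = Covers Z 𝓑 → ∣ Z ∣ ℕ.≤ k

module _ (H : Graph) (k : ℕ) where
  open Graph H using (_~_)
  open TreeDecomposition

  AdmissibleDecomposition : List (Subset (order H)) → Set₁
  AdmissibleDecomposition 𝓑 = Σ[ D ∈ TreeDecomposition H ] (∀ t → Admissible k 𝓑 (bag D t))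

  module _
    {𝓑 : List (Subset (order H))} (bramble : Bramble H 𝓑)
    {X : Subset (order H)} (X-covers : Covers X 𝓑) (∣X∣≤k : ∣ X ∣ ℕ.≤ k)
    (X-min : ∀ {Z} → Covers Z 𝓑 → ∣ X ∣ ℕ.≤ ∣ Z ∣)
    {C : Subset (order H)} (C∩X=∅ : ∀ {u} → u ∈ₛ C → u ∉ₛ X)
    (C-closed : ∀ {u w} → u ∈ₛ C → u ~ w → w ∈ₛ C ⊎ w ∈ₛ X)
    where
    open Bramble bramble

    -- If the walk visits C, its last vertex in C is followed by a vertex of X, because neighbours
    -- of C lie in C or X; the rest of the walk from there avoids C.
    exitThroughX : ∀ {B : Subset (order H)} {z y} → y ∉ₛ C → Walk H (_∈ₛ B) z y →
                   (z ∉ₛ C × Walk H (λ x → x ∈ₛ B × x ∉ₛ C) z y) ⊎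
                   ∃[ x ] (x ∈ₛ X × x ∈ₛ B × Walk H (λ x → x ∈ₛ B × x ∉ₛ C) x y)
    exitThroughX y∉ ε = inj₁ (y∉ , ε)
    exitThroughX {z = z} y∉ ((z∈B , z′∈B , e) ◅ w) with exitThroughX y∉ w
    ... | inj₂ r = inj₂ r
    ... | inj₁ (z′∉ , w′) with z Subset.∈? C
    ...   | no z∉ = inj₁ (z∉ , ((z∈B , z∉) , (z′∈B , z′∉) , e) ◅ w′)
    ...   | yes z∈ with C-closed z∈ e
    ...     | inj₁ z′∈ = contradiction z′∈ z′∉
    ...     | inj₂ z′∈ = inj₂ (_ , z′∈ , z′∈B , w′)

    module _ (D : TreeDecomposition H) (s : Vertex (tree D))
             (s-covers : Covers (bag D s) 𝓑) (s∩C=∅ : ∀ {u} → u ∈ₛ bag D s → u ∉ₛ C)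
             (D-admissible : ∀ t → Admissible k (C ∷ 𝓑) (bag D t)) where

      private
        T = tree D

        home : Vertex H → Vertex T
        home x = proj₁ (vertex-nonempty D x)

        route : ∀ x → ∃[ ys ] Path (Graph._~_ T) (home x) s ys
        route x = loopErase (proj₂ (proj₁ (isTree D)) (home x) s)

        onRoute : Vertex H → List (Vertex T)
        onRoute x = proj₁ (route x)

        -- Each vertex of X is dragged along its route to s, so that all of X arrives in the bag at
        -- s.
        InBag : Vertex T → Pred (Vertex H) 0ℓ
        InBag t v = (v ∈ₛ X × t ∈ onRoute v) ⊎ (v ∈ₛ bag D t × v ∈ₛ X ∪ C)

        inBag? : ∀ t → Decidable (InBag t)
        inBag? t v = ((v Subset.∈? X) ×-dec (t ∈? onRoute v)) ⊎-dec
                     ((v Subset.∈? bag D t) ×-dec (v Subset.∈? (X ∪ C)))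
          where open DecMembership (Fin._≟_ {order T}) using (_∈?_)

        W : Vertex T → Subset (order H)
        W t = select (inBag? t)

        W⊆ : ∀ {v t} → v ∈ₛ W t → v ∈ₛ X ∪ C
        W⊆ {v} {t} v∈ with ∈-select⁻ (inBag? t) v∈
        ... | inj₁ (p , _) = Subset.p⊆p∪q C p
        ... | inj₂ (_ , q) = q

        -- For v in X, the route and the old subtree share the node `home v`; for v outside X, the
        -- old subtree is kept.
        W-connected : ∀ v → InducesConnected T (λ t → v ∈ₛ W t)
        W-connected v with v Subset.∈? X
        ... | yes v∈X = connected-via T (home v) toHome
          where
          onRoute⇒ : ∀ {t} → t ∈ onRoute v → v ∈ₛ W t
          onRoute⇒ {t} p = ∈-select⁺ (inBag? t) (inj₁ (v∈X , p))
          inBag⇒ : ∀ {t} → v ∈ₛ bag D t → v ∈ₛ W t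
          inBag⇒ {t} p = ∈-select⁺ (inBag? t) (inj₂ (p , Subset.p⊆p∪q C v∈X))
          toHome : ∀ {t} → v ∈ₛ W t → Walk T (λ t → v ∈ₛ W t) t (home v)
          toHome {t} v∈ with ∈-select⁻ (inBag? t) v∈
          ... | inj₁ (_ , p) = walk-mono T onRoute⇒ (path-connected T (proj₂ (route v)) p (start∈ (proj₂ (route v))))
          ... | inj₂ (p , _) = walk-mono T inBag⇒ (vertex-connected D v p (proj₂ (vertex-nonempty D v)))
        ... | no v∉X = λ p q → walk-mono T (to (W⊆ p)) (vertex-connected D v (from p) (from q))
          where
          from : ∀ {t} → v ∈ₛ W t → v ∈ₛ bag D t
          from {t} v∈ with ∈-select⁻ (inBag? t) v∈
          ... | inj₁ (p , _) = contradiction p v∉X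
          ... | inj₂ (p , _) = p
          to : ∀ {t} → v ∈ₛ X ∪ C → v ∈ₛ bag D t → v ∈ₛ W t
          to {t} v∈ p = ∈-select⁺ (inBag? t) (inj₂ (p , v∈))

        -- The nodes whose bags meet P contain a walk from `home x` to s, hence also the route,
        -- which is the simple path between them.
        onRoute-hits : ∀ {P : Pred (Vertex H) 0ℓ} {x y t} → P x → y ∈ₛ bag D s → Walk H P x y →
                       t ∈ onRoute x → Hits D P t
        onRoute-hits {x = x} px y∈ w =
          All.lookup (path⊆walk T (noCycle⇒acyclic T (proj₂ (isTree D))) (proj₂ (route x))
                       (x , px , proj₂ (vertex-nonempty D x))
                       (trace-walk D px (proj₂ (vertex-nonempty D x)) y∈ w))

        -- A walk in B ∈ 𝓑 from X to the bag at s can be shortened to avoid C, as it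
        -- leaves C only through X; it then meets the bag at t outside C.
        smaller-cover : ∀ t → Covers ((X ∩ ∁ (W t)) ∪ (bag D t ∩ ∁ C)) 𝓑
        smaller-cover t = All.tabulate hit
          where
          X′ : Subset (order H)
          X′ = (X ∩ ∁ (W t)) ∪ (bag D t ∩ ∁ C)
          inX : ∀ {x} → x ∈ₛ X → x ∉ₛ W t → x ∈ₛ X′
          inX p q = Subset.p⊆p∪q _ (Subset.x∈p∩q⁺ (p , Subset.x∉p⇒x∈∁p q))
          inBag : ∀ {x} → x ∈ₛ bag D t → x ∉ₛ C → x ∈ₛ X′
          inBag p q = Subset.q⊆p∪q (X ∩ ∁ (W t)) _ (Subset.x∈p∩q⁺ (p , Subset.x∉p⇒x∈∁p q))
          hit : ∀ {B} → B ∈ 𝓑 → ∃[ x ] (x ∈ₛ B × x ∈ₛ X′)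
          hit {B} B∈ with All.lookup X-covers B∈ | All.lookup s-covers B∈
          ... | b , b∈B , b∈X | y , y∈B , y∈s = Sum.[ (λ (_ , w) → viaWalk b∈X b∈B w)
                                                  , (λ (_ , p , q , w) → viaWalk p q w) ]′
                                                  (exitThroughX (s∩C=∅ y∈s) (connected B∈ b∈B y∈B))
            where
            viaWalk : ∀ {x} → x ∈ₛ X → x ∈ₛ B → Walk H (λ x → x ∈ₛ B × x ∉ₛ C) x y → ∃[ x ] (x ∈ₛ B × x ∈ₛ X′)
            viaWalk {x} x∈X x∈B w with x Subset.∈? W t
            ... | no x∉ = x , x∈B , inX x∈X x∉
            ... | yes x∈ with ∈-select⁻ (inBag? t) x∈
            ...   | inj₂ (p , _) = x , x∈B , inBag p (flip C∩X=∅ x∈X)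
            ...   | inj₁ (_ , p) with onRoute-hits (x∈B , flip C∩X=∅ x∈X) y∈s w p
            ...     | v , (v∈B , v∉C) , v∈t = v , v∈B , inBag v∈t v∉C

        -- If `W t` were larger, `exchange-<` would make the cover from `smaller-cover` smaller than
        -- X.
        ∣W∣≤∣bag∣ : ∀ t → ∣ W t ∣ ℕ.≤ ∣ bag D t ∣
        ∣W∣≤∣bag∣ t = ℕ.≮⇒≥ λ lt →
          ℕ.<⇒≱ (exchange-< X (W t) (bag D t) C outside-C inside-C lt) (X-min (smaller-cover t))
          where
          outside-C : ∀ {x} → x ∈ₛ W t → x ∉ₛ C → x ∈ₛ X
          outside-C x∈ x∉C = Sum.[ id , flip contradiction x∉C ]′ (Subset.x∈p∪q⁻ X C (W⊆ x∈))
          inside-C : ∀ {x} → x ∈ₛ W t → x ∈ₛ C → x ∈ₛ bag D t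
          inside-C x∈ x∈C = Sum.[ (λ (p , _) → contradiction p (C∩X=∅ x∈C)) , proj₁ ]′ (∈-select⁻ (inBag? t) x∈)

        -- If the old bag meets C and `W t` covers 𝓑, then the old bag covers `C ∷ 𝓑`: a vertex of B
        -- brought to t by its route can be replaced by another vertex of B in the old bag, by
        -- `onRoute-hits`. So the old bag has size at most k, and `W t` is no larger. If the old bag
        -- misses C, then `W t` lies in X.
        W-admissible : ∀ t → Admissible k 𝓑 (W t)
        W-admissible t covers with Fin.any? (λ c → (c Subset.∈? C) ×-dec (c Subset.∈? bag D t))
        ... | yes hitsC = ℕ.≤-trans (∣W∣≤∣bag∣ t) (D-admissible t (hitsC ∷ All.tabulate hit))
          where
          hit : ∀ {B} → B ∈ 𝓑 → ∃[ x ] (x ∈ₛ B × x ∈ₛ bag D t)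
          hit B∈ with All.lookup covers B∈ | All.lookup s-covers B∈
          ... | x , x∈B , x∈W | y , y∈B , y∈s with ∈-select⁻ (inBag? t) x∈W
          ...   | inj₂ (p , _) = x , x∈B , p
          ...   | inj₁ (_ , p) = onRoute-hits x∈B y∈s (connected B∈ x∈B y∈B) p
        ... | no missesC = ℕ.≤-trans (Subset.p⊆q⇒∣p∣≤∣q∣ W⊆X) ∣X∣≤k
          where
          W⊆X : ∀ {x} → x ∈ₛ W t → x ∈ₛ X
          W⊆X x∈ with ∈-select⁻ (inBag? t) x∈
          ... | inj₁ (p , _) = p
          ... | inj₂ (p , q) = Sum.[ id , (λ c → contradiction (_ , c , p) missesC) ]′ (Subset.x∈p∪q⁻ X C q)

      reroute : Σ[ E ∈ PartialDecomposition H (Admissible k 𝓑) (X ∪ C) ]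
                  ∃[ r ] (∀ {v} → v ∈ₛ X → v ∈ₛ PartialDecomposition.bag E r)
      reroute = record
        { tree             = T
        ; isTree           = isTree D
        ; bag              = W
        ; bag⊆             = W⊆
        ; vertex-nonempty  = λ {v} v∈ → home v , keep v∈ (proj₂ (vertex-nonempty D v))
        ; vertex-connected = W-connected
        ; edge-covered     = λ u∈ v∈ e → let (t , p , q) = edge-covered D e in t , keep u∈ p , keep v∈ q
        ; admissible       = W-admissible
        } , s , λ {v} v∈ → ∈-select⁺ (inBag? s) (inj₁ (v∈ , end∈ (proj₂ (route v))))
        where
        keep : ∀ {v t} → v ∈ₛ X ∪ C → v ∈ₛ bag D t → v ∈ₛ W t
        keep {t = t} v∈ p = ∈-select⁺ (inBag? t) (inj₂ (p , v∈))

  module _ (coverable : ∀ 𝓑 → Bramble H 𝓑 → ∃[ X ] (Covers X 𝓑 × ∣ X ∣ ℕ.≤ k)) where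

    private
      module _ (𝓑 : List (Subset (order H))) (bramble : Bramble H 𝓑)
               (extend : ∀ C → C ∉ 𝓑 → Bramble H (C ∷ 𝓑) → AdmissibleDecomposition (C ∷ 𝓑))
               {X : Subset (order H)} (X-covers : Covers X 𝓑) (∣X∣≤k : ∣ X ∣ ℕ.≤ k)
               (X-min : ∀ {Z} → Covers Z 𝓑 → ∣ X ∣ ℕ.≤ ∣ Z ∣) where

        -- A common interface for two supports, C ∪ N(C) and X ∪ C. Only the part of X in the
        -- support has to appear at the root.
        record Piece (C : Subset (order H)) : Set₁ where
          field
            support        : Subset (order H)
            decomposition  : PartialDecomposition H (Admissible k 𝓑) support
            root           : Vertex (PartialDecomposition.tree decomposition)
            X-at-root      : ∀ {v} → v ∈ₛ support → v ∈ₛ X → v ∈ₛ PartialDecomposition.bag decomposition root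
            contains       : ∀ {v} → v ∈ₛ C → v ∈ₛ support
            contains-nbrs  : ∀ {u v} → u ∈ₛ C → u ~ v → v ∈ₛ support
            within         : ∀ {v} → v ∈ₛ support → v ∈ₛ C ⊎ v ∈ₛ X

        -- As C does not touch B, the bag C ∪ N(C) misses B. It does not cover 𝓑 and is admissible
        -- whatever its size.
        neighbourhoodBag : ∀ {B C} → B ∈ 𝓑 → ¬ Touch H C B →
                           (∀ {u w} → u ∈ₛ C → u ~ w → w ∈ₛ C ⊎ w ∈ₛ X) → Piece C
        neighbourhoodBag {B} {C} B∈ ¬touch closed = record
          { support       = N
          ; decomposition = singleBag N admissible
          ; root          = zero
          ; X-at-root     = λ p _ → p
          ; contains      = ∈-select⁺ N? ∘ inj₁
          ; contains-nbrs = λ p e → ∈-select⁺ N? (inj₂ (_ , p , e))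
          ; within        = λ p → Sum.[ inj₁ , (λ (_ , q , e) → closed q e) ]′ (∈-select⁻ N? p)
          }
          where
          N? : Decidable (λ v → v ∈ₛ C ⊎ ∃[ u ] (u ∈ₛ C × u ~ v))
          N? v = (v Subset.∈? C) ⊎-dec Fin.any? (λ u → (u Subset.∈? C) ×-dec (Graph._~?_ H u v))
          N : Subset (order H)
          N = select N?
          admissible : Admissible k 𝓑 N
          admissible covers with All.lookup covers B∈
          ... | x , x∈B , x∈N = contradiction
            (Sum.[ (λ x∈C → x , x , (x∈C , x∈B) , inj₁ refl) , (λ (u , u∈C , e) → u , x , (u∈C , x∈B) , inj₂ e) ]′
              (∈-select⁻ N? x∈N)) ¬touch

        piece : ∀ {C v} → v ∈ₛ C → InducesConnected H (_∈ₛ C) → (∀ {u} → u ∈ₛ C → u ∉ₛ X) →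
                (∀ {u w} → u ∈ₛ C → u ~ w → w ∈ₛ C ⊎ w ∈ₛ X) → AdmissibleDecomposition 𝓑 ⊎ Piece C
        piece {C} {v} v∈C C-conn disjoint closed with All.all? (touch? H C) 𝓑
        ... | no ¬all with find (All.¬All⇒Any¬ (touch? H C) 𝓑 ¬all)
        ...   | B , B∈ , ¬touch = inj₂ (neighbourhoodBag B∈ ¬touch closed)
        piece {C} {v} v∈C C-conn disjoint closed | yes touchAll
          with extend C C∉𝓑 (record
            { connected = λ { (here refl) → C-conn ; (there B∈) → Bramble.connected bramble B∈ }
            ; touching  = λ { (here refl) (here refl) → v , v , (v∈C , v∈C) , inj₁ refl
                            ; (here refl) (there B∈)  → All.lookup touchAll B∈
                            ; (there A∈) (here refl)  → touch-sym H (All.lookup touchAll A∈)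
                            ; (there A∈) (there B∈)   → Bramble.touching bramble A∈ B∈ } })
          where
          -- Every member of 𝓑 meets X, whereas C does not.
          C∉𝓑 : C ∉ 𝓑
          C∉𝓑 C∈ with All.lookup X-covers C∈
          ... | x , x∈C , x∈X = disjoint x∈C x∈X
        ... | D , D-adm with Fin.any? (λ t → covers? 𝓑 (bag D t) ×-dec (k ℕ.<? ∣ bag D t ∣))
        -- Either D already serves for 𝓑, which ends the whole construction, or some bag larger than
        -- k covers 𝓑 and X can be rerouted to it.
        ...   | no good = inj₁ (D , λ t covers → ℕ.≮⇒≥ λ lt → good (t , covers , lt))
        ...   | yes (s , s-covers , k<) = inj₂ (record
          { support       = X ∪ C
          ; decomposition = proj₁ E
          ; root          = proj₁ (proj₂ E)
          ; X-at-root     = λ _ → proj₂ (proj₂ E)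
          ; contains      = Subset.q⊆p∪q X C
          ; contains-nbrs = λ u∈ e → Sum.[ Subset.q⊆p∪q X C , Subset.p⊆p∪q C ]′ (closed u∈ e)
          ; within        = Sum.swap ∘ Subset.x∈p∪q⁻ X C
          })
          where
          E = reroute bramble X-covers ∣X∣≤k X-min disjoint closed D s s-covers
                -- If the bag at s met C, it would cover `C ∷ 𝓑` and so have size at most k.
                (λ u∈s u∈C → ℕ.<⇒≱ k< (D-adm s ((_ , u∈C , u∈s) ∷ s-covers))) D-adm

        -- By `closed`, the support is X together with whole components of H - X; this makes the
        -- component of a vertex not yet reached disjoint from it.
        record Assembly (vs : List (Vertex H)) : Set₁ where
          field
            support       : Subset (order H)
            decomposition : PartialDecomposition H (Admissible k 𝓑) support
            root          : Vertex (PartialDecomposition.tree decomposition)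
            X-at-root     : ∀ {v} → v ∈ₛ X → v ∈ₛ PartialDecomposition.bag decomposition root
            closed        : ∀ {u w} → u ∈ₛ support → u ∉ₛ X → u ~ w → w ∈ₛ support
            contains      : ∀ {v} → v ∈ vs → v ∈ₛ support

          X⊆ : ∀ {v} → v ∈ₛ X → v ∈ₛ support
          X⊆ = PartialDecomposition.bag⊆ decomposition ∘ X-at-root

        -- The piece and the old support overlap only in X, and the overlap lies in both root bags.
        -- An edge with an end outside the old support has that end in C, so both its ends lie in
        -- the piece.
        attach : ∀ {vs v C} (A : Assembly vs) → v ∈ₛ C → (∀ {u} → u ∈ₛ C → u ∉ₛ Assembly.support A) →
                 Piece C → Assembly (v ∷ vs)
        attach {C = C} A v∈C disjoint P
          with glue A.decomposition P.decomposition A.root P.root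
                 (λ v∈A v∈P → Sum.[ (λ v∈C → contradiction v∈A (disjoint v∈C))
                                  , (λ v∈X → A.X-at-root v∈X , P.X-at-root v∈P v∈X) ]′ (P.within v∈P))
                 edges
          where
          module A = Assembly A
          module P = Piece P
          fresh : ∀ {v} → v ∈ₛ A.support ∪ P.support → v ∉ₛ A.support → v ∈ₛ C
          fresh v∈ v∉ = Sum.[ flip contradiction v∉
                            , (λ v∈P → Sum.[ id , (λ v∈X → contradiction (A.X⊆ v∈X) v∉) ]′ (P.within v∈P)) ]′
                            (Subset.x∈p∪q⁻ A.support P.support v∈)
          edges : ∀ {u v} → u ∈ₛ A.support ∪ P.support → v ∈ₛ A.support ∪ P.support → u ~ v →
                  (u ∈ₛ A.support × v ∈ₛ A.support) ⊎ (u ∈ₛ P.support × v ∈ₛ P.support)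
          edges {u} {v} u∈ v∈ e with u Subset.∈? A.support | v Subset.∈? A.support
          ... | yes p | yes q = inj₁ (p , q)
          ... | no p  | _     = inj₂ (P.contains (fresh u∈ p) , P.contains-nbrs (fresh u∈ p) e)
          ... | yes _ | no q  = inj₂ (P.contains-nbrs (fresh v∈ q) (Graph.~-sym H e) , P.contains (fresh v∈ q))
        ... | J , r , bag≡ = record
          { support       = A.support ∪ P.support
          ; decomposition = J
          ; root          = r
          ; X-at-root     = λ v∈ → subst (_ ∈ₛ_) (sym bag≡) (A.X-at-root v∈)
          ; closed        = λ u∈ u∉X e → Sum.[ (λ p → Subset.p⊆p∪q _ (A.closed p u∉X e))
                                             , (λ p → Sum.[ (λ q → Subset.q⊆p∪q A.support _ (P.contains-nbrs q e))
                                                          , flip contradiction u∉X ]′ (P.within p)) ]′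
                                             (Subset.x∈p∪q⁻ A.support P.support u∈)
          ; contains      = λ { (here refl) → Subset.q⊆p∪q A.support _ (P.contains v∈C)
                              ; (there v∈) → Subset.p⊆p∪q _ (A.contains v∈) }
          }
          where
          module A = Assembly A
          module P = Piece P

        assemble : ∀ vs → AdmissibleDecomposition 𝓑 ⊎ Assembly vs
        assemble [] = inj₂ (record
          { support       = X
          ; decomposition = singleBag X (λ _ → ∣X∣≤k)
          ; root          = zero
          ; X-at-root     = id
          ; closed        = λ p q → contradiction p q
          ; contains      = λ ()
          })
        assemble (v ∷ vs) with assemble vs
        ... | inj₁ D = inj₁ D
        ... | inj₂ A with v Subset.∈? Assembly.support A
        ...   | yes v∈ = inj₂ (record
          { Assembly A
          ; contains = λ { (here refl) → v∈ ; (there w∈) → Assembly.contains A w∈ } })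
        ...   | no v∉ with component H X v (v∉ ∘ Assembly.X⊆ A)
        ...     | C , v∈C , C-conn , C∩X , C-closed =
          Sum.map₂ (attach A v∈C disjoint) (piece v∈C C-conn C∩X C-closed)
          where
          -- A step from outside the support into it, read backwards, would leave the support from a
          -- vertex outside X, against `closed`.
          stays : ∀ {x y} → x ∉ₛ Assembly.support A → Walk H (_∈ₛ C) x y → y ∉ₛ Assembly.support A
          stays x∉ ε = x∉
          stays x∉ ((_ , z∈C , e) ◅ w) =
            stays (λ z∈ → x∉ (Assembly.closed A z∈ (C∩X z∈C) (Graph.~-sym H e))) w
          disjoint : ∀ {u} → u ∈ₛ C → u ∉ₛ Assembly.support A
          disjoint u∈ = stays v∉ (C-conn v∈C u∈)

        admissible-step : AdmissibleDecomposition 𝓑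
        admissible-step with assemble (allFin (order H))
        ... | inj₁ D = D
        ... | inj₂ A = whole (Assembly.decomposition A) (λ v → Assembly.contains A (∈-allFin v))

      -- R lists the sets outside the bramble; the induction is on its length.
      admissible-exists : ∀ m 𝓑 (R : List (Subset (order H))) → length R ℕ.≤ m → (∀ S → S ∈ R ⊎ S ∈ 𝓑) →
                          Bramble H 𝓑 → AdmissibleDecomposition 𝓑
      admissible-exists m 𝓑 R ∣R∣≤m total bramble with coverable 𝓑 bramble
      ... | X₀ , covers₀ , ∣X₀∣≤k with smallest (covers? 𝓑) X₀ covers₀
      ...   | X , X-covers , X-min =
        admissible-step 𝓑 bramble (extend m ∣R∣≤m) X-covers (ℕ.≤-trans (X-min covers₀) ∣X₀∣≤k) X-min
        where
        extend : ∀ m → length R ℕ.≤ m → ∀ C → C ∉ 𝓑 → Bramble H (C ∷ 𝓑) → AdmissibleDecomposition (C ∷ 𝓑)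
        extend m ∣R∣≤m C C∉ bramble′ with total C
        ... | inj₂ C∈ = contradiction C∈ C∉
        ... | inj₁ C∈ with ∈-∃++ C∈
        -- C moves from R to the bramble. As R contains C, its length is positive, so m is a
        -- successor.
        ...   | xs , ys , refl with m | subst (ℕ._≤ m) (trans (length-++ xs) (ℕ.+-suc (length xs) (length ys))) ∣R∣≤m
        ...     | suc m′ | s≤s le =
          admissible-exists m′ (C ∷ 𝓑) (xs ++ ys) (subst (ℕ._≤ m′) (sym (length-++ xs)) le) total′ bramble′
          where
          total′ : ∀ S → S ∈ xs ++ ys ⊎ S ∈ C ∷ 𝓑
          total′ S with total S
          ... | inj₂ S∈ = inj₂ (there S∈)
          ... | inj₁ S∈ with ∈-++⁻ xs S∈
          ...   | inj₁ S∈xs         = inj₁ (∈-++⁺ˡ S∈xs)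
          ...   | inj₂ (here refl)  = inj₂ (here refl)
          ...   | inj₂ (there S∈ys) = inj₁ (∈-++⁺ʳ xs S∈ys)

    smallBags : Σ[ D ∈ TreeDecomposition H ] (∀ t → ∣ bag D t ∣ ℕ.≤ k)
    -- Every set covers the empty bramble, so admissibility for it is the bound k on all bags.
    smallBags with admissible-exists _ [] (allSubsets _) ℕ.≤-refl (inj₁ ∘ ∈-allSubsets)
                     (record { connected = λ () ; touching = λ () })
    ... | D , adm = D , λ t → adm t []

-- Brambles and strong products

∣++∣ : ∀ {m n} (p : Subset m) (q : Subset n) → ∣ p Vec.++ q ∣ ≡ ∣ p ∣ ℕ.+ ∣ q ∣
∣++∣ []            q = refl
∣++∣ (inside ∷ p)  q = cong suc (∣++∣ p q)
∣++∣ (outside ∷ p) q = ∣++∣ p q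

∣concat∣≥ : ∀ {m n b} (S : Vec (Subset n) m) (P : Subset m) →
            (∀ {g} → g ∈ₛ P → b ℕ.≤ ∣ Vec.lookup S g ∣) → ∣ P ∣ ℕ.* b ℕ.≤ ∣ Vec.concat S ∣
∣concat∣≥ [] [] h = z≤n
∣concat∣≥ {b = b} (p ∷ S) (inside ∷ P) h = subst (b ℕ.+ ∣ P ∣ ℕ.* b ℕ.≤_) (sym (∣++∣ p (Vec.concat S)))
  (ℕ.+-mono-≤ (h Vec.here) (∣concat∣≥ S P (h ∘ Vec.there)))
∣concat∣≥ (p ∷ S) (outside ∷ P) h = subst (_ ℕ.≤_) (sym (∣++∣ p (Vec.concat S)))
  (ℕ.m≤n⇒m≤o+n ∣ p ∣ (∣concat∣≥ S P (h ∘ Vec.there)))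

slice : ∀ {m n} → Fin m → Subset (m ℕ.* n) → Subset n
slice g S = Vec.tabulate (λ h → Vec.lookup S (combine g h))

∈-slice⁺ : ∀ {m n} {g : Fin m} {h : Fin n} {S} → combine g h ∈ₛ S → h ∈ₛ slice g S
∈-slice⁺ {g = g} {h} p = Vec.lookup⇒[]= h _ (trans (Vec.lookup∘tabulate _ h) (Vec.[]=⇒lookup p))

∈-slice⁻ : ∀ {m n} {g : Fin m} {h : Fin n} {S} → h ∈ₛ slice g S → combine g h ∈ₛ S
∈-slice⁻ {g = g} {h} p = Vec.lookup⇒[]= _ _ (trans (sym (Vec.lookup∘tabulate _ h)) (Vec.[]=⇒lookup p))

-- The slices are the consecutive blocks of length n of the vector S, and their sizes add up to that
-- of S.
∣slices∣ : ∀ {m n b} (S : Subset (m ℕ.* n)) (P : Subset m) →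
           (∀ {g} → g ∈ₛ P → b ℕ.≤ ∣ slice g S ∣) → ∣ P ∣ ℕ.* b ℕ.≤ ∣ S ∣
∣slices∣ {m} {n} {b} S P h with Vec.group m n S
... | xss , refl = ∣concat∣≥ xss P λ {g} g∈ → subst (λ s → b ℕ.≤ ∣ s ∣) (slice-concat g) (h g∈)
  where
  slice-concat : ∀ g → slice g (Vec.concat xss) ≡ Vec.lookup xss g
  slice-concat g = trans (Vec.tabulate-cong (Vec.lookup-concat xss g)) (Vec.tabulate∘lookup _)

module _ (G H : Graph) where
  private
    module G = Graph G
    module H = Graph H
    module GH = Graph (G ⊠ H)

  Adjacent : Rel (Vertex G × Vertex H) 0ℓ
  Adjacent (g , h) (g′ , h′) = (g ≡ g′ × h H.~ h′) ⊎ (g G.~ g′ × h ≡ h′) ⊎ (g G.~ g′ × h H.~ h′)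

  ⊠-adjacent : ∀ {g h g′ h′} → Adjacent (g , h) (g′ , h′) → combine g h GH.~ combine g′ h′
  ⊠-adjacent {g} {h} {g′} {h′} =
    subst₂ Adjacent (sym (Fin.remQuot-combine g h)) (sym (Fin.remQuot-combine g′ h′))

  module _ (D : TreeDecomposition (G ⊠ H)) {𝓑 : List (Subset (order H))} (bramble : Bramble H 𝓑) where
    open TreeDecomposition D
    open Bramble bramble

    private
      acyclic : Acyclic tree
      acyclic = noCycle⇒acyclic tree (proj₂ isTree)

      -- This is the set {g} × B in the strong product.
      Copy : Vertex G × Subset (order H) → Pred (Vertex (G ⊠ H)) 0ℓ
      Copy (g , B) v = ∃[ h ] (h ∈ₛ B × v ≡ combine g h)

      F : Vertex G × Subset (order H) → Pred (Vertex tree) 0ℓ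
      F i = Hits D (Copy i)

      F? : ∀ i → Decidable (F i)
      F? (g , B) t = Fin.any? λ v →
        Fin.any? (λ h → (h Subset.∈? B) ×-dec (v Fin.≟ combine g h)) ×-dec (v Subset.∈? bag t)

      copy-connected : ∀ {g B} → B ∈ 𝓑 → InducesConnected (G ⊠ H) (Copy (g , B))
      copy-connected {g} B∈ (h , p , refl) (h′ , p′ , refl) = Star.gmap (combine g)
        (λ (q , q′ , e) → (_ , q , refl) , (_ , q′ , refl) , ⊠-adjacent (inj₁ (refl , e)))
        (connected B∈ p p′)

      F-connected : ∀ {g B} → B ∈ 𝓑 → InducesConnected tree (F (g , B))
      F-connected B∈ = trace-connected D (copy-connected B∈)

      -- Take a in A and b in B where these sets touch. The vertices (x , a) and (y , b) are equal
      -- or adjacent in the strong product, so they share a bag.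
      F-meet : ∀ {x y A B} → A ∈ 𝓑 → B ∈ 𝓑 → x ≡ y ⊎ x G.~ y → ∃[ t ] (F (x , A) t × F (y , B) t)
      F-meet {x} {y} A∈ B∈ x~y with touching A∈ B∈
      ... | a , b , (a∈ , b∈) , a~b with shared x~y a~b
        where
        shared : x ≡ y ⊎ x G.~ y → a ≡ b ⊎ a H.~ b →
                 ∃[ t ] (combine x a ∈ₛ bag t × combine y b ∈ₛ bag t)
        shared (inj₁ refl) (inj₁ refl) = let (t , p) = vertex-nonempty (combine x a) in t , p , p
        shared (inj₁ p) (inj₂ e) = edge-covered (⊠-adjacent (inj₁ (p , e)))
        shared (inj₂ e) (inj₁ p) = edge-covered (⊠-adjacent (inj₂ (inj₁ (e , p))))
        shared (inj₂ e) (inj₂ f) = edge-covered (⊠-adjacent (inj₂ (inj₂ (e , f))))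
      ...   | t , p , q = t , (_ , (a , a∈ , refl) , p) , (_ , (b , b∈ , refl) , q)

      Covered : Vertex G → Vertex tree → Set
      Covered g t = ∀ B → B ∈ 𝓑 → F (g , B) t

      -- The Helly property is applied to the subtrees of g and of g′ together, starting from the
      -- whole tree; they meet pairwise by `F-meet`.
      covered-meet : ∀ {g g′} → g ≡ g′ ⊎ g G.~ g′ → ∃[ t ] (Covered g t × Covered g′ t)
      covered-meet {g} {g′} e
        with helly tree acyclic F F? (λ _ → ⊤) (λ _ _ → Star.map (λ s → tt , tt , s) (proj₂ (proj₁ isTree) _ _))
               (proj₁ (proj₁ isTree) , tt) (cartesianProduct ends 𝓑)
               (λ i∈ → F-connected (inB i∈))
               (λ i∈ → let (t , p , _) = F-meet (inB i∈) (inB i∈) (inj₁ refl) in t , tt , p)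
               (λ i∈ j∈ → F-meet (inB i∈) (inB j∈) (close (inEnds i∈) (inEnds j∈)))
        where
        ends : List (Vertex G)
        ends = g ∷ g′ ∷ []
        inB : ∀ {i} → i ∈ cartesianProduct ends 𝓑 → proj₂ i ∈ 𝓑
        inB i∈ = proj₂ (∈-cartesianProduct⁻ ends 𝓑 i∈)
        inEnds : ∀ {i} → i ∈ cartesianProduct ends 𝓑 → proj₁ i ∈ ends
        inEnds i∈ = proj₁ (∈-cartesianProduct⁻ ends 𝓑 i∈)
        close : ∀ {x y} → x ∈ ends → y ∈ ends → x ≡ y ⊎ x G.~ y
        close (here refl)         (here refl)         = inj₁ refl
        close (here refl)         (there (here refl)) = e
        close (there (here refl)) (here refl)         = Sum.map sym G.~-sym e
        close (there (here refl)) (there (here refl)) = inj₁ refl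
      ... | t , _ , all = t , (λ _ B∈ → all (∈-cartesianProduct⁺ {xs = g ∷ g′ ∷ []} (here refl) B∈))
                            , (λ _ B∈ → all (∈-cartesianProduct⁺ {xs = g ∷ g′ ∷ []} (there (here refl)) B∈))

      -- The simple path between two such nodes lies in every subtree F (g , B) with B in 𝓑.
      covered-connected : ∀ g → InducesConnected tree (Covered g)
      covered-connected g {s} {t} p q with loopErase (proj₂ (proj₁ isTree) s t)
      ... | _ , π = walk-mono tree
        (λ u∈ B B∈ → All.lookup (path⊆walk tree acyclic π (p B B∈) (F-connected B∈ (p B B∈) (q B B∈))) u∈)
        (path-connected tree π (start∈ π) (end∈ π))

      fibre : Vertex G → Vertex tree → Subset (order H)
      fibre g t = slice {order G} g (bag t)

      -- A form of `Covered` that speaks of the fibre, so that it is decidable by `covers?` and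
      -- gives a lower bound on the size of the fibre.
      Thick : Vertex tree → Pred (Vertex G) 0ℓ
      Thick t g = Covers (fibre g t) 𝓑

      thick? : ∀ t → Decidable (Thick t)
      thick? t g = covers? 𝓑 (fibre g t)

      bigBag : Vertex tree → Subset (order G)
      bigBag t = select (thick? t)

      ∈-bigBag⁺ : ∀ {g t} → Covered g t → g ∈ₛ bigBag t
      ∈-bigBag⁺ {g} {t} c = ∈-select⁺ {P = Thick t} (thick? t) (All.tabulate hit)
        where
        hit : ∀ {B} → B ∈ 𝓑 → ∃[ h ] (h ∈ₛ B × h ∈ₛ fibre g t)
        hit B∈ with c _ B∈
        ... | _ , (h , h∈ , refl) , v∈ = h , h∈ , ∈-slice⁺ {order G} v∈

      ∈-bigBag⁻ : ∀ {g t} → g ∈ₛ bigBag t → Covered g t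
      ∈-bigBag⁻ {g} {t} g∈ B B∈ with All.lookup covers B∈
        where
        covers : Thick t g
        covers = ∈-select⁻ {P = Thick t} (thick? t) g∈
      ... | h , h∈B , h∈ = combine g h , (h , h∈B , refl) , ∈-slice⁻ {order G} h∈

    quotient : TreeDecomposition G
    quotient = record
      { tree             = tree
      ; isTree           = isTree
      ; bag              = bigBag
      ; vertex-nonempty  = λ g → let (t , c , _) = covered-meet {g} (inj₁ refl) in t , ∈-bigBag⁺ c
      ; vertex-connected = λ g p q → walk-mono tree ∈-bigBag⁺ (covered-connected g (∈-bigBag⁻ p) (∈-bigBag⁻ q))
      ; edge-covered     = λ e → let (t , c , c′) = covered-meet (inj₂ e) in t , ∈-bigBag⁺ c , ∈-bigBag⁺ c′
      }

    -- Each vertex of `bigBag t` accounts for at least k + 1 elements of the bag at t. Division by k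
    -- + 1 turns this into one bound on all bags of the quotient, as `maxBagSize≤` requires.
    quotient-bound : ∀ k → (∀ {Z} → Covers Z 𝓑 → k ℕ.< ∣ Z ∣) →
                     TreeDecomposition.maxBagSize quotient ℕ.* suc k ℕ.≤ maxBagSize
    quotient-bound k large = ℕ.≤-trans
      (ℕ.*-monoˡ-≤ (suc k) (maxBagSize≤ quotient bagBound)) (m/n*n≤m maxBagSize (suc k))
      where
      open ℕ.≤-Reasoning
      bagBound : ∀ t → ∣ bigBag t ∣ ℕ.≤ maxBagSize ℕ./ suc k
      bagBound t = begin
        ∣ bigBag t ∣                        ≡⟨ m*n/n≡m ∣ bigBag t ∣ (suc k) ⟨
        (∣ bigBag t ∣ ℕ.* suc k) ℕ./ suc k  ≤⟨ /-monoˡ-≤ (suc k) (ℕ.≤-trans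
          (∣slices∣ (bag t) (bigBag t) λ g∈ → large (∈-select⁻ {P = Thick t} (thick? t) g∈)) (bag≤maxBagSize D t)) ⟩
        maxBagSize ℕ./ suc k                ∎

-- From bag sizes to treewidth

open TreeDecomposition using (width; maxBagSize)

-1+1 : ∀ i → i - 1ℤ + 1ℤ ≡ i
-1+1 i = trans (ℤ.+-assoc i _ _) (ℤ.+-identityʳ i)

width-≤⇒maxBagSize-≤ : ∀ {G} (D E : TreeDecomposition G) → width D ℤ.≤ width E → maxBagSize D ℕ.≤ maxBagSize E
width-≤⇒maxBagSize-≤ D E p =
  ℤ.drop‿+≤+ (subst₂ ℤ._≤_ (-1+1 _) (-1+1 _) (ℤ.+-monoˡ-≤ 1ℤ p))

-- Suppose the bound fails for b = k + 1. A bramble of H with no cover of size at most k would force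
-- `maxBagSize D` to be at least a(k + 1), through `quotient`. So every bramble has such a cover,
-- and duality gives a decomposition of H with all bags of size at most k, a contradiction.
maxBagSize-⊠ : ∀ {G H} a b → (∀ D → a ℕ.≤ maxBagSize {G} D) → (∀ D → b ℕ.≤ maxBagSize {H} D) →
               (D : TreeDecomposition (G ⊠ H)) → a ℕ.* b ℕ.≤ maxBagSize D
-- This case includes the null graph H, of treewidth -1.
maxBagSize-⊠ a zero _ _ D = subst (ℕ._≤ maxBagSize D) (sym (ℕ.*-zeroʳ a)) z≤n
maxBagSize-⊠ {G} {H} a (suc k) minG minH D with a ℕ.* suc k ℕ.≤? maxBagSize D
... | yes p = p
... | no ¬p = contradiction (ℕ.≤-trans (minH E) (maxBagSize≤ E E-small)) (ℕ.<⇒≱ (ℕ.n<1+n k))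
  where
  coverable : ∀ 𝓑 → Bramble H 𝓑 → ∃[ X ] (Covers X 𝓑 × ∣ X ∣ ℕ.≤ k)
  coverable 𝓑 bramble with Subset.anySubset? (λ X → covers? 𝓑 X ×-dec (∣ X ∣ ℕ.≤? k))
  ... | yes r = r
  ... | no none = contradiction
    (ℕ.≤-trans (ℕ.*-monoˡ-≤ (suc k) (minG (quotient G H D bramble)))
      (quotient-bound G H D bramble k λ c → ℕ.≰⇒> λ le → none (_ , c , le)))
    ¬p
  E : TreeDecomposition H
  E = proj₁ (smallBags H k coverable)
  E-small = proj₂ (smallBags H k coverable)

theorem1 : (G H : Graph) (twG twH twGH : ℤ) →
    IsTreewidth G twG → IsTreewidth H twH → IsTreewidth (G ⊠ H) twGH →
    twGH ≥ (twG + 1ℤ) * (twH + 1ℤ) - 1ℤ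
theorem1 G H _ _ _ ((D , refl) , minD) ((E , refl) , minE) ((J , refl) , _) =
  -- Width plus one is the maximum bag size, so the claim is `bound` with 1 subtracted on both
  -- sides.
  ℤ.+-monoˡ-≤ (ℤ.- 1ℤ) (subst (ℤ._≤ ℤ.+ maxBagSize J) product (ℤ.+≤+ bound))
  where
  bound : maxBagSize D ℕ.* maxBagSize E ℕ.≤ maxBagSize J
  bound = maxBagSize-⊠ (maxBagSize D) (maxBagSize E)
    (λ D′ → width-≤⇒maxBagSize-≤ D D′ (minD D′)) (λ E′ → width-≤⇒maxBagSize-≤ E E′ (minE E′)) J
  product : ℤ.+ (maxBagSize D ℕ.* maxBagSize E) ≡ (width D + 1ℤ) * (width E + 1ℤ)
  product = trans (ℤ.pos-* (maxBagSize D) (maxBagSize E)) (sym (cong₂ _*_ (-1+1 (ℤ.+ maxBagSize D)) (-1+1 (ℤ.+ maxBagSize E))))
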